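{- For all positive integers $m,n$, $\Lambda(m,n)=\left([0,1)^{m\times n}\times[0,1)^m\right)\setminus\mathbf{Bad}(m,n)$.
   Context: $[0,1)^{m\times n}$ is the set of real $m\times n$ matrices with entries in $[0,1)$. For $\boldsymbol{x}\in\mathbb{R}^n$, $\|\boldsymbol{x}\|=\max_i|x_i|$; for $\boldsymbol{y}\in\mathbb{R}^m$, $\langle\boldsymbol{y}\rangle=\min_{\boldsymbol{p}\in\mathbb{Z}^m}\|\boldsymbol{y}-\boldsymbol{p}\|$. For $\psi:\mathbb{N}\to[0,\infty)$, $W_{m,n}(\psi)$ is the set of pairs $(A,\boldsymbol{\gamma})\in[0,1)^{m\times n}\times[0,1)^m$ such that $\langle A\boldsymbol{q}-\boldsymbol{\gamma}\rangle<\psi(\|\boldsymbol{q}\|)$ for infinitely many $\boldsymbol{q}\in\mathbb{Z}^n$. "Decreasing" means non-increasing. $\mathcal{C}$ is the set of decreasing $\psi:\mathbb{N}\to[0,\infty)$ with $\sum_{q\ge1}q^{n-1}\psi(q)^m<\infty$. $\Lambda(m,n)=\bigcup_{\psi\in\mathcal{C}}W_{m,n}(\psi)$. $\mathbf{Bad}(m,n)=\{(A,\boldsymbol{\gamma})\in[0,1)^{m\times n}\times[0,1)^m:\liminf_{\boldsymbol{q}\in\mathbb{Z}^n,\|\boldsymbol{q}\|\to\infty}\|\boldsymbol{q}\|^n\langle A\boldsymbol{q}-\boldsymbol{\gamma}\rangle^m>0\}$. -}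

module Defs where

open import Algebra.Bundles using (CommutativeRing; Semiring)
open import Algebra.Core using (Op₁; Op₂)
import Algebra.Construct.NaturalChoice.Max as Max
import Algebra.Definitions.RawSemiring as RawSemiring
import Algebra.Properties.Ring as RingProperties
open import Algebra.Structures using (IsCommutativeRing)
open import Data.Fin.Base using (zero; suc; toℕ)
open import Data.Integer.Base as ℤ using (ℤ; +_; -[1+_])
open import Data.List.Base using (List)
open import Data.List.Relation.Unary.Any using (Any)
open import Data.Nat.Base as ℕ using (ℕ; zero; suc; pred)
import Data.Nat.Properties as ℕ
open import Data.Product.Base using (Σ-syntax; ∃-syntax; _×_; _,_; proj₁; proj₂)
open import Data.Sum.Base using (inj₁; inj₂)
open import Data.Vec.Functional using (Vector; foldr; map)
open import Function.Base using (_∘_)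
open import Level using (0ℓ)
open import Relation.Binary.Bundles using (TotalOrder)
import Relation.Binary.Construct.Add.Extrema.NonStrict as ExtremaNonStrict
import Relation.Binary.Construct.Add.Extrema.Strict as ExtremaStrict
import Relation.Binary.Construct.StrictToNonStrict as StrictToNonStrict
open import Relation.Binary.Core using (Rel)
open import Relation.Binary.PropositionalEquality.Core as ≡ using (_≗_)
open import Relation.Binary.Structures using (IsStrictTotalOrder)
open import Relation.Nullary.Construct.Add.Extrema using (_±; [_])
open import Relation.Nullary.Negation.Core using (¬_)
open import Relation.Unary using (Pred; _∈_; Satisfiable; ⋃)

-- A Dedekind-complete ordered field, i.e. the real numbers up to isomorphism.
-- Classically `archimedean` follows from `complete`; it is a field so that the
-- minimum defining the distance to the nearest integer point exists without
-- appealing to excluded middle.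

record Reals : Set₁ where
  infix  4 _≈_ _<_
  infixl 6 _+_
  infixl 7 _*_
  infix  8 -_
  field
    ℝ                  : Set
    _≈_ _<_            : Rel ℝ 0ℓ
    _+_ _*_            : Op₂ ℝ
    -_                 : Op₁ ℝ
    0# 1#              : ℝ
    isCommutativeRing  : IsCommutativeRing _≈_ _+_ _*_ -_ 0# 1#
    inverse            : ∀ x → ¬ x ≈ 0# → ∃[ y ] x * y ≈ 1#
    isStrictTotalOrder : IsStrictTotalOrder _≈_ _<_
    0<1                : 0# < 1#
    +-monoˡ-<          : ∀ {x y} z → x < y → x + z < y + z
    *-pos              : ∀ {x y} → 0# < x → 0# < y → 0# < x * y

  open StrictToNonStrict _≈_ _<_ public using (_≤_)

  commutativeRing : CommutativeRing 0ℓ 0ℓ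
  commutativeRing = record { isCommutativeRing = isCommutativeRing }

  open CommutativeRing commutativeRing public using (_-_)

  open RawSemiring (Semiring.rawSemiring (CommutativeRing.semiring commutativeRing)) public
    using (_^_; sum) renaming (_×_ to _·_)

  field
    archimedean : ∀ x → ∃[ n ] x < n · 1#
    complete    : (P : Pred ℝ 0ℓ) → Satisfiable P →
                  (∃[ b ] ∀ {x} → x ∈ P → x ≤ b) →
                  ∃[ s ] (∀ {x} → x ∈ P → x ≤ s) ×
                         (∀ {b} → (∀ {x} → x ∈ P → x ≤ b) → s ≤ b)

  totalOrder : TotalOrder 0ℓ 0ℓ 0ℓ
  totalOrder = record
    { isTotalOrder = StrictToNonStrict.isTotalOrder _≈_ _<_ isStrictTotalOrder }

  open Max totalOrder public using (_⊔_)

module Approximation (ℛ : Reals) where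
  open Reals ℛ

  ι : ℤ → ℝ
  ι (+ n)    = n · 1#
  ι -[1+ n ] = - (suc n · 1#)

  ∣_∣ : ℝ → ℝ
  ∣ x ∣ = x ⊔ - x

  ‖_‖ : ∀ {n} → Vector ℝ n → ℝ
  ‖ x ‖ = foldr _⊔_ 0# (map ∣_∣ x)

  -- The norm of an integer vector, as a natural number so that it can be an
  -- argument of ψ; see `‖‖ᶻ-correct`.
  ‖_‖ᶻ : ∀ {n} → Vector ℤ n → ℕ
  ‖ q ‖ᶻ = foldr ℕ._⊔_ 0 (map ℤ.∣_∣ q)

  infixl 6 _-ᵥ_
  _-ᵥ_ : ∀ {n} → Vector ℝ n → Vector ℝ n → Vector ℝ n
  (x -ᵥ y) i = x i - y i

  Matrix : ℕ → ℕ → Set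
  Matrix m n = Vector (Vector ℝ n) m

  infixl 7 _*ᵥ_
  _*ᵥ_ : ∀ {m n} → Matrix m n → Vector ℝ n → Vector ℝ m
  (A *ᵥ x) i = sum (λ j → A i j * x j)

  module NearestPoint where
    module R = CommutativeRing commutativeRing
    module RP = RingProperties R.ring
    module O = TotalOrder totalOrder
    module S = IsStrictTotalOrder isStrictTotalOrder
    module M = Max totalOrder

    ≤-respʳ : ∀ {x y z} → y ≈ z → x ≤ y → x ≤ z
    ≤-respʳ y≈z x≤y = O.trans x≤y (inj₂ y≈z)

    ≤-respˡ : ∀ {x y z} → x ≈ y → x ≤ z → y ≤ z
    ≤-respˡ x≈y x≤z = O.trans (inj₂ (R.sym x≈y)) x≤z

    +-monoˡ-≤ : ∀ {x y} z → x ≤ y → x + z ≤ y + z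
    +-monoˡ-≤ z (inj₁ x<y) = inj₁ (+-monoˡ-< z x<y)
    +-monoˡ-≤ z (inj₂ x≈y) = inj₂ (R.+-congʳ x≈y)

    +-monoʳ-≤ : ∀ {x y} z → x ≤ y → z + x ≤ z + y
    +-monoʳ-≤ z x≤y =
      ≤-respˡ (R.+-comm _ z) (≤-respʳ (R.+-comm _ z) (+-monoˡ-≤ z x≤y))

    +-mono-≤ : ∀ {x y u v} → x ≤ y → u ≤ v → x + u ≤ y + v
    +-mono-≤ {y = y} {u = u} x≤y u≤v = O.trans (+-monoˡ-≤ u x≤y) (+-monoʳ-≤ y u≤v)

    +-cancelˡ-≤ : ∀ {x y} z → z + x ≤ z + y → x ≤ y
    +-cancelˡ-≤ {x} {y} z p = ≤-respˡ (lem x) (≤-respʳ (lem y) (+-monoʳ-≤ (- z) p))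
      where
      lem : ∀ w → - z + (z + w) ≈ w
      lem w = R.trans (R.sym (R.+-assoc _ _ _))
                (R.trans (R.+-congʳ (R.-‿inverseˡ z)) (R.+-identityˡ w))

    ∣∣-cong : ∀ {x y} → x ≈ y → ∣ x ∣ ≈ ∣ y ∣
    ∣∣-cong x≈y = M.⊔-cong x≈y (R.-‿cong x≈y)

    x≤∣x∣ : ∀ x → x ≤ ∣ x ∣
    x≤∣x∣ x = M.x≤x⊔y x (- x)

    -x≤∣x∣ : ∀ x → - x ≤ ∣ x ∣
    -x≤∣x∣ x = M.x≤y⊔x x (- x)

    triangle : ∀ x y → ∣ y ∣ ≤ ∣ x ∣ + ∣ x - y ∣
    triangle x y = M.⊔-lub
      (≤-respˡ eq₁ (+-mono-≤ (x≤∣x∣ x) (-x≤∣x∣ (x - y))))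
      (≤-respˡ eq₂ (+-mono-≤ (-x≤∣x∣ x) (x≤∣x∣ (x - y))))
      where
      eq₂ : - x + (x - y) ≈ - y
      eq₂ = R.trans (R.sym (R.+-assoc _ _ _))
              (R.trans (R.+-congʳ (R.-‿inverseˡ x)) (R.+-identityˡ _))
      eq₁ : x + - (x - y) ≈ y
      eq₁ = R.trans (R.+-congˡ (R.sym (RP.-‿+-comm x (- y))))
              (R.trans (R.sym (R.+-assoc _ _ _))
                (R.trans (R.+-congʳ (R.-‿inverseʳ x))
                  (R.trans (R.+-identityˡ _) (RP.-‿involutive y))))

    ·-nonneg : ∀ n → 0# ≤ n · 1#
    ·-nonneg zero    = O.refl
    ·-nonneg (suc n) =
      ≤-respˡ (R.+-identityˡ 0#) (+-mono-≤ (inj₁ 0<1) (·-nonneg n))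

    ·-mono : ∀ {m n} → m ℕ.≤ n → m · 1# ≤ n · 1#
    ·-mono (ℕ.z≤n {n}) = ·-nonneg n
    ·-mono (ℕ.s≤s m≤n) = +-monoʳ-≤ 1# (·-mono m≤n)

    neg-nonpos : ∀ {x} → 0# ≤ x → - x ≤ x
    neg-nonpos {x} 0≤x = O.trans
      (≤-respˡ (R.+-identityʳ _)
        (≤-respʳ (R.-‿inverseˡ x) (+-monoʳ-≤ (- x) 0≤x)))
      0≤x

    ∣ι∣ : ∀ z → ∣ ι z ∣ ≈ ℤ.∣ z ∣ · 1#
    ∣ι∣ (+ n)    = M.x≤y⇒y⊔x≈y (neg-nonpos (·-nonneg n))
    ∣ι∣ -[1+ n ] = R.trans
      (M.⊔-cong R.refl (RP.-‿involutive _))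
      (M.x≤y⇒x⊔y≈y (neg-nonpos (·-nonneg (suc n))))

    ·-⊔ : ∀ a b → (a ℕ.⊔ b) · 1# ≈ (a · 1#) ⊔ (b · 1#)
    ·-⊔ a b with ℕ.≤-total a b
    ... | inj₁ a≤b = R.trans (R.reflexive (≡.cong (_· 1#) (ℕ.m≤n⇒m⊔n≡n a≤b)))
                       (R.sym (M.x≤y⇒x⊔y≈y (·-mono a≤b)))
    ... | inj₂ b≤a = R.trans (R.reflexive (≡.cong (_· 1#) (ℕ.m≥n⇒m⊔n≡m b≤a)))
                       (R.sym (M.x≤y⇒y⊔x≈y (·-mono b≤a)))

    ‖‖-mono : ∀ {n} (x y : Vector ℝ n) → (∀ i → ∣ x i ∣ ≤ ∣ y i ∣) → ‖ x ‖ ≤ ‖ y ‖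
    ‖‖-mono {zero}  x y le = O.refl
    ‖‖-mono {suc n} x y le =
      M.⊔-mono-≤ (le zero) (‖‖-mono (x ∘ suc) (y ∘ suc) (le ∘ suc))

    _minimises_ : ℤ → ℝ → Set
    k minimises y = ∀ j → ∣ y - ι k ∣ ≤ ∣ y - ι j ∣

    better : ∀ y (a b : ℤ) → ∃[ k ] ∣ y - ι k ∣ ≤ ∣ y - ι a ∣ × ∣ y - ι k ∣ ≤ ∣ y - ι b ∣
    better y a b with O.total ∣ y - ι a ∣ ∣ y - ι b ∣
    ... | inj₁ a≤b = a , O.refl , a≤b
    ... | inj₂ b≤a = b , b≤a , O.refl

    best : ∀ y N → ∃[ k ] ∀ j → ℤ.∣ j ∣ ℕ.≤ N → ∣ y - ι k ∣ ≤ ∣ y - ι j ∣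
    best y zero    = + 0 , λ { (+ zero) _ → O.refl }
    best y (suc N) with best y N
    ... | k₀ , k₀-best with better y (+ suc N) -[1+ N ]
    ... | k₁ , k₁≤+ , k₁≤- with better y k₀ k₁
    ... | k , k≤k₀ , k≤k₁ = k , least
      where
      least : ∀ j → ℤ.∣ j ∣ ℕ.≤ suc N → ∣ y - ι k ∣ ≤ ∣ y - ι j ∣
      least j ∣j∣≤ with ℕ.m≤n⇒m<n∨m≡n ∣j∣≤
      least j         _ | inj₁ (ℕ.s≤s ∣j∣≤N) = O.trans k≤k₀ (k₀-best j ∣j∣≤N)
      least (+ _)     _ | inj₂ ≡.refl        = O.trans k≤k₁ k₁≤+
      least -[1+ _ ]  _ | inj₂ ≡.refl        = O.trans k≤k₁ k₁≤-

    nearest : ∀ y → ∃[ k ] k minimises y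
    nearest y with archimedean (∣ y ∣ + ∣ y ∣)
    ... | N , 2∣y∣<N with best y N
    ... | k , k-best = k , least
      where
      least : k minimises y
      least j with ℕ.≤-total ℤ.∣ j ∣ N
      ... | inj₁ ∣j∣≤N = k-best j ∣j∣≤N
      ... | inj₂ N≤∣j∣ = O.trans (k-best (+ 0) ℕ.z≤n)
        (≤-respˡ (∣∣-cong (R.sym y-0))
          (+-cancelˡ-≤ ∣ y ∣
            (O.trans (inj₁ 2∣y∣<N)
              (O.trans (≤-respʳ (R.sym (∣ι∣ j)) (·-mono N≤∣j∣)) (triangle y (ι j))))))
        where
        y-0 : y - 0# ≈ y
        y-0 = R.trans (R.+-congˡ RP.-0#≈0#) (R.+-identityʳ y)

    ‖‖ᶻ-correct : ∀ {n} (q : Vector ℤ n) → ‖ q ‖ᶻ · 1# ≈ ‖ map ι q ‖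
    ‖‖ᶻ-correct {zero}  q = R.refl
    ‖‖ᶻ-correct {suc n} q = R.trans (·-⊔ ℤ.∣ q zero ∣ ‖ q ∘ suc ‖ᶻ)
      (M.⊔-cong (R.sym (∣ι∣ (q zero))) (‖‖ᶻ-correct (q ∘ suc)))

    nearestPoint : ∀ {m} (y : Vector ℝ m) →
                   Σ[ p ∈ Vector ℤ m ] ∀ p′ → ‖ y -ᵥ map ι p ‖ ≤ ‖ y -ᵥ map ι p′ ‖
    nearestPoint y =
      (λ i → proj₁ (nearest (y i))) ,
      (λ p′ → ‖‖-mono _ _ (λ i → proj₂ (nearest (y i)) (p′ i)))

  open NearestPoint public using (nearestPoint; ‖‖ᶻ-correct)

  ⟨_⟩ : ∀ {m} → Vector ℝ m → ℝ
  ⟨ y ⟩ = ‖ y -ᵥ map ι (proj₁ (nearestPoint y)) ‖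

  Cube : ∀ m n → Pred (Matrix m n × Vector ℝ m) 0ℓ
  Cube m n (A , γ) = (∀ i j → InUnit (A i j)) × (∀ i → InUnit (γ i))
    where
    InUnit : ℝ → Set
    InUnit x = 0# ≤ x × x < 1#

  -- Integer vectors are functions, so finiteness is up to pointwise equality.
  Finite : ∀ {n} → Pred (Vector ℤ n) 0ℓ → Set
  Finite {n} P = Σ[ qs ∈ List (Vector ℤ n) ] ∀ {q} → q ∈ P → Any (q ≗_) qs

  W : ∀ m n → (ℕ → ℝ) → Pred (Matrix m n × Vector ℝ m) 0ℓ
  W m n ψ (A , γ) = (A , γ) ∈ Cube m n ×
    ¬ Finite (λ (q : Vector ℤ n) → ⟨ A *ᵥ map ι q -ᵥ γ ⟩ < ψ ‖ q ‖ᶻ)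

  Converges : (ℕ → ℝ) → Set
  Converges s = ∃[ l ] ∀ {ε} → 0# < ε → ∃[ N ] ∀ {k} → N ℕ.≤ k → ∣ s k - l ∣ < ε

  -- The sum runs over q = 1, …, k.
  partialSum : (ℕ → ℝ) → ℕ → ℝ
  partialSum a k = sum {k} (λ i → a (suc (toℕ i)))

  record 𝒞 (m n : ℕ) : Set where
    field
      ψ          : ℕ → ℝ
      nonneg     : ∀ q → 0# ≤ ψ q
      decreasing : ∀ {p q} → p ℕ.≤ q → ψ q ≤ ψ p
      summable   : Converges (partialSum (λ q → (q · 1#) ^ pred n * ψ q ^ m))

  Λ : ∀ m n → Pred (Matrix m n × Vector ℝ m) 0ℓ
  Λ m n = ⋃[ c ∶ 𝒞 m n ] W m n (𝒞.ψ c)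

  open ExtremaNonStrict _≤_ public using (_≤±_)
  open ExtremaStrict _<_ public using (_<±_)

  IsInf IsSup : {I : Set} → (I → ℝ ±) → ℝ ± → Set
  IsInf f l = (∀ i → l ≤± f i) × (∀ b → (∀ i → b ≤± f i) → b ≤± l)
  IsSup f u = (∀ i → f i ≤± u) × (∀ b → (∀ i → f i ≤± b) → u ≤± b)

  -- The limit inferior as ‖q‖ → ∞, in the extended reals: the supremum over N of
  -- the infimum over ‖q‖ ≥ N. It may be +∞.
  IsLimInf : ∀ {n} → (Vector ℤ n → ℝ) → ℝ ± → Set
  IsLimInf {n} f l = Σ[ t ∈ (ℕ → ℝ ±) ]
    (∀ N → IsInf {Σ[ q ∈ Vector ℤ n ] N ℕ.≤ ‖ q ‖ᶻ} (λ (q , _) → [ f q ]) (t N)) ×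
    IsSup t l

  Bad : ∀ m n → Pred (Matrix m n × Vector ℝ m) 0ℓ
  Bad m n (A , γ) = (A , γ) ∈ Cube m n ×
    ∃[ l ] IsLimInf {n} (λ q → (‖ q ‖ᶻ · 1#) ^ n * ⟨ A *ᵥ map ι q -ᵥ γ ⟩ ^ m) l ×
           [ 0# ] <± l

{-# OPTIONS --safe #-}
module Submission where

-- If ψ is decreasing and ∑ qⁿ⁻¹ ψ(q)ᵐ converges, then qⁿ ψ(q)ᵐ → 0, so infinitely
-- many solutions of ⟨Aq - γ⟩ < ψ(‖q‖) force the limit inferior to be 0.
-- Conversely, if the limit inferior is 0, choose points q₀, q₁, … of increasing
-- norm Qₖ and radii δ₀ ≥ δ₁ ≥ … with ⟨A qₖ - γ⟩ < δₖ and Qₖⁿ δₖᵐ < 2⁻ᵏ. The step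
-- function ψ equal to δₖ on (Qₖ₋₁, Qₖ] satisfies ∑ qⁿ⁻¹ ψ(q)ᵐ ≤ ∑ Qₖⁿ δₖᵐ ≤ 2.

open import Defs
open import Axiom.ExcludedMiddle using (ExcludedMiddle)
open import Data.Nat.Base using (ℕ; NonZero)
open import Level using (0ℓ)
open import Relation.Unary using (_≐_; _∖_)

import Algebra.Properties.CommutativeSemiring.Exp as Exp
import Algebra.Properties.Monoid.Sum as Sum
import Algebra.Properties.Semiring.Mult as Mult
open import Axiom.DoubleNegationElimination using (em⇒dne)
open import Data.Fin.Base as Fin using (toℕ)
open import Data.Fin.Properties using (toℕ-fromℕ; toℕ-inject₁)
open import Data.Integer.Base as ℤ using (ℤ; +_; -[1+_])
open import Data.List.Base as List using (List; []; _∷_; cartesianProductWith; upTo; _++_)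
open import Data.List.Membership.Propositional.Properties using (∈-map⁺; ∈-++⁺ˡ; ∈-++⁺ʳ; ∈-upTo⁺)
import Data.List.Membership.Propositional as List
open import Data.List.Relation.Unary.Any using (Any; here; there)
open import Data.List.Relation.Unary.Any.Properties using (cartesianProductWith⁺)
open import Data.Nat.Base as ℕ using (zero; suc; z≤n; s≤s; ⌊_/2⌋; ⌈_/2⌉)
import Data.Nat.Properties as ℕ
open import Data.Product.Base using (Σ-syntax; ∃-syntax; _×_; _,_; proj₁; proj₂)
open import Data.Sum.Base using (inj₁; inj₂)
open import Data.Vec.Functional as Vector using (Vector)
open import Function.Base using (_∘_; case_of_)
open import Relation.Binary.Bundles using (StrictPartialOrder)
import Relation.Binary.Construct.Add.Extrema.NonStrict as ExtremaNonStrict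
import Relation.Binary.Construct.Add.Extrema.Strict as ExtremaStrict
import Relation.Binary.Construct.Add.Supremum.NonStrict as SupremumNonStrict
import Relation.Binary.Construct.StrictToNonStrict as StrictToNonStrict
open import Relation.Binary.Core using (Rel)
open import Relation.Binary.Definitions using (Reflexive; Transitive; tri<; tri≈; tri>)
open import Relation.Binary.PropositionalEquality.Core as ≡ using (_≡_; _≗_)
import Relation.Binary.Reasoning.StrictPartialOrder as StrictPartialOrderReasoning
open import Relation.Nullary.Construct.Add.Extrema using (⊥±; ⊤±; [_])
open import Relation.Nullary.Decidable.Core using (Dec; yes; no)
open import Relation.Nullary.Negation.Core using (¬_; contradiction)
open import Relation.Unary using (Pred; _∈_)

-- Stated for an arbitrary preorder because it serves partial sums under `≤`, radii under the
-- reversed order, and levels in `ℕ`.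
step⇒mono : ∀ {A : Set} {_~_ : Rel A 0ℓ} → Reflexive _~_ → Transitive _~_ →
            (f : ℕ → A) → (∀ k → f k ~ f (suc k)) → ∀ {p q} → p ℕ.≤ q → f p ~ f q
step⇒mono {_~_ = _~_} refl trans f step p≤q = go (ℕ.≤⇒≤′ p≤q)
  where
  go : ∀ {p q} → p ℕ.≤′ q → f p ~ f q
  go (ℕ.≤′-reflexive ≡.refl) = refl
  go (ℕ.≤′-step p≤q)         = trans (go p≤q) (step _)

-- Arithmetic of order, products and powers in an ordered field.

module OrderedField (ℛ : Reals) where
  open Reals ℛ
  open Approximation ℛ
  open NearestPoint public
    using (module R; module RP; module O; module S; module M; +-monoˡ-≤; +-monoʳ-≤;
           +-mono-≤; +-cancelˡ-≤; x≤∣x∣; -x≤∣x∣; ·-nonneg; ·-mono)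
  open Exp R.commutativeSemiring public using (^-distrib-*; ^-congˡ)
  open Mult R.semiring public using (×-homo-+; ×-assoc-*)

  strictPartialOrder : StrictPartialOrder 0ℓ 0ℓ 0ℓ
  strictPartialOrder = record { isStrictPartialOrder = S.isStrictPartialOrder }

  open StrictPartialOrderReasoning strictPartialOrder public

  <-≤-trans : ∀ {x y z} → x < y → y ≤ z → x < z
  <-≤-trans = StrictToNonStrict.<-≤-trans _≈_ _<_ S.trans (proj₁ S.<-resp-≈)

  ≤-<-trans : ∀ {x y z} → x ≤ y → y < z → x < z
  ≤-<-trans = StrictToNonStrict.≤-<-trans _≈_ _<_ S.Eq.sym S.trans (proj₂ S.<-resp-≈)

  ≤⇒≯ : ∀ {x y} → x ≤ y → ¬ y < x
  ≤⇒≯ x≤y y<x = S.irrefl R.refl (≤-<-trans x≤y y<x)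

  ≮⇒≥ : ∀ {x y} → ¬ x < y → y ≤ x
  ≮⇒≥ {x} {y} x≮y with S.compare x y
  ... | tri< x<y _ _ = contradiction x<y x≮y
  ... | tri≈ _ x≈y _ = inj₂ (R.sym x≈y)
  ... | tri> _ _ y<x = inj₁ y<x

  +-monoʳ-< : ∀ {x y} z → x < y → z + x < z + y
  +-monoʳ-< {x} {y} z x<y = begin-strict
    z + x  ≈⟨ R.+-comm z x ⟩
    x + z  <⟨ +-monoˡ-< z x<y ⟩
    y + z  ≈⟨ R.+-comm y z ⟩
    z + y  ∎

  +-cancelˡ-< : ∀ {x y} z → z + x < z + y → x < y
  +-cancelˡ-< z p with S.compare _ _
  ... | tri< x<y _ _ = x<y
  ... | tri≈ _ x≈y _ = contradiction p (≤⇒≯ (+-monoʳ-≤ z (inj₂ (R.sym x≈y))))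
  ... | tri> _ _ y<x = contradiction p (≤⇒≯ (+-monoʳ-≤ z (inj₁ y<x)))

  x≤y+x : ∀ {x y} → 0# ≤ y → x ≤ y + x
  x≤y+x {x} {y} 0≤y = begin
    x       ≈⟨ R.+-identityˡ x ⟨
    0# + x  ≤⟨ +-monoˡ-≤ x 0≤y ⟩
    y + x   ∎

  x≤x+y : ∀ {x y} → 0# ≤ y → x ≤ x + y
  x≤x+y {x} {y} 0≤y = begin
    x      ≤⟨ x≤y+x 0≤y ⟩
    y + x  ≈⟨ R.+-comm y x ⟩
    x + y  ∎

  x-y+y : ∀ x y → x - y + y ≈ x
  x-y+y x y = R.trans (R.+-assoc x (- y) y)
    (R.trans (R.+-congˡ (R.-‿inverseˡ y)) (R.+-identityʳ x))

  x-y<z⇒x<z+y : ∀ {x y z} → x - y < z → x < z + y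
  x-y<z⇒x<z+y {x} {y} {z} p = begin-strict
    x          ≈⟨ x-y+y x y ⟨
    x - y + y  <⟨ +-monoˡ-< y p ⟩
    z + y      ∎

  *-monoʳ-< : ∀ {x y} z → 0# < z → x < y → z * x < z * y
  *-monoʳ-< {x} {y} z 0<z x<y = begin-strict
    z * x                     ≈⟨ R.+-identityˡ _ ⟨
    0# + z * x                <⟨ +-monoˡ-< _ (*-pos 0<z 0<y-x) ⟩
    z * (y - x) + z * x       ≈⟨ R.distribˡ z (y - x) x ⟨
    z * (y - x + x)           ≈⟨ R.*-congˡ (x-y+y y x) ⟩
    z * y                     ∎
    where
    0<y-x : 0# < y - x
    0<y-x = begin-strict
      0#     ≈⟨ R.-‿inverseʳ x ⟨
      x - x  <⟨ +-monoˡ-< (- x) x<y ⟩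
      y - x  ∎

  *-monoʳ-≤ : ∀ {x y} z → 0# ≤ z → x ≤ y → z * x ≤ z * y
  *-monoʳ-≤ z (inj₁ 0<z) (inj₁ x<y) = inj₁ (*-monoʳ-< z 0<z x<y)
  *-monoʳ-≤ z _          (inj₂ x≈y) = inj₂ (R.*-congˡ x≈y)
  *-monoʳ-≤ z (inj₂ 0≈z) (inj₁ _)   = inj₂ (R.trans (zero* _) (R.sym (zero* _)))
    where
    zero* : ∀ w → z * w ≈ 0#
    zero* w = R.trans (R.*-congʳ (R.sym 0≈z)) (R.zeroˡ w)

  *-monoˡ-≤ : ∀ {x y} z → 0# ≤ z → x ≤ y → x * z ≤ y * z
  *-monoˡ-≤ {x} {y} z 0≤z x≤y = begin
    x * z  ≈⟨ R.*-comm x z ⟩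
    z * x  ≤⟨ *-monoʳ-≤ z 0≤z x≤y ⟩
    z * y  ≈⟨ R.*-comm z y ⟩
    y * z  ∎

  *-mono-≤ : ∀ {x y u v} → 0# ≤ x → 0# ≤ u → x ≤ y → u ≤ v → x * u ≤ y * v
  *-mono-≤ 0≤x 0≤u x≤y u≤v =
    O.trans (*-monoʳ-≤ _ 0≤x u≤v) (*-monoˡ-≤ _ (O.trans 0≤u u≤v) x≤y)

  *-cancelˡ-< : ∀ {x y} z → 0# ≤ z → z * x < z * y → x < y
  *-cancelˡ-< {x} {y} z 0≤z p with S.compare x y
  ... | tri< x<y _ _ = x<y
  ... | tri≈ _ x≈y _ = contradiction p (≤⇒≯ (*-monoʳ-≤ z 0≤z (inj₂ (R.sym x≈y))))
  ... | tri> _ _ y<x = contradiction p (≤⇒≯ (*-monoʳ-≤ z 0≤z (inj₁ y<x)))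

  *-nonneg : ∀ {x y} → 0# ≤ x → 0# ≤ y → 0# ≤ x * y
  *-nonneg {x} {y} 0≤x 0≤y = begin
    0#      ≈⟨ R.zeroʳ x ⟨
    x * 0#  ≤⟨ *-monoʳ-≤ x 0≤x 0≤y ⟩
    x * y   ∎

  ^-pos : ∀ {x} n → 0# < x → 0# < x ^ n
  ^-pos zero    0<x = 0<1
  ^-pos (suc n) 0<x = *-pos 0<x (^-pos n 0<x)

  ^-nonneg : ∀ {x} n → 0# ≤ x → 0# ≤ x ^ n
  ^-nonneg zero    0≤x = inj₁ 0<1
  ^-nonneg (suc n) 0≤x = *-nonneg 0≤x (^-nonneg n 0≤x)

  ^-monoˡ-≤ : ∀ {x y} n → 0# ≤ x → x ≤ y → x ^ n ≤ y ^ n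
  ^-monoˡ-≤ zero    0≤x x≤y = O.refl
  ^-monoˡ-≤ (suc n) 0≤x x≤y = *-mono-≤ 0≤x (^-nonneg n 0≤x) x≤y (^-monoˡ-≤ n 0≤x x≤y)

  ^-cancelˡ-< : ∀ {x y} n → 0# ≤ y → x ^ n < y ^ n → x < y
  ^-cancelˡ-< {x} {y} n 0≤y p with S.compare x y
  ... | tri< x<y _ _ = x<y
  ... | tri≈ _ x≈y _ = contradiction p (S.irrefl (^-congˡ n x≈y))
  ... | tri> _ _ y<x = contradiction p (≤⇒≯ (^-monoˡ-≤ n 0≤y (inj₁ y<x)))

  x≤1⇒x^n≤1 : ∀ {x} n → 0# ≤ x → x ≤ 1# → x ^ n ≤ 1#
  x≤1⇒x^n≤1 zero    0≤x x≤1 = O.refl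
  x≤1⇒x^n≤1 {x} (suc n) 0≤x x≤1 = begin
    x * x ^ n  ≤⟨ *-mono-≤ 0≤x (^-nonneg n 0≤x) x≤1 (x≤1⇒x^n≤1 n 0≤x x≤1) ⟩
    1# * 1#    ≈⟨ R.*-identityˡ 1# ⟩
    1#         ∎

  1≤x⇒1≤x^n : ∀ {x} n → 1# ≤ x → 1# ≤ x ^ n
  1≤x⇒1≤x^n zero    1≤x = O.refl
  1≤x⇒1≤x^n {x} (suc n) 1≤x = begin
    1#         ≈⟨ R.*-identityˡ 1# ⟨
    1# * 1#    ≤⟨ *-mono-≤ (inj₁ 0<1) (inj₁ 0<1) 1≤x (1≤x⇒1≤x^n n 1≤x) ⟩
    x * x ^ n  ∎

  1≤x⇒y≤x*y : ∀ {x y} → 0# ≤ y → 1# ≤ x → y ≤ x * y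
  1≤x⇒y≤x*y {x} {y} 0≤y 1≤x = begin
    y       ≈⟨ R.*-identityˡ y ⟨
    1# * y  ≤⟨ *-monoˡ-≤ y 0≤y 1≤x ⟩
    x * y   ∎

  pos-inverse : ∀ {x} → 0# < x → ∃[ y ] 0# < y × x * y ≈ 1#
  pos-inverse {x} 0<x with inverse x (S.irrefl R.refl ∘ <-≤-trans 0<x ∘ inj₂)
  ... | y , xy≈1 = y , *-cancelˡ-< x (inj₁ 0<x) x0<xy , xy≈1
    where
    x0<xy : x * 0# < x * y
    x0<xy = begin-strict
      x * 0#  ≈⟨ R.zeroʳ x ⟩
      0#      <⟨ 0<1 ⟩
      1#      ≈⟨ xy≈1 ⟨
      x * y   ∎

  0<1+1 : 0# < 1# + 1#
  0<1+1 = <-≤-trans 0<1 (x≤x+y (inj₁ 0<1))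

  ½ : ℝ
  ½ = proj₁ (pos-inverse 0<1+1)

  0<½ : 0# < ½
  0<½ = proj₁ (proj₂ (pos-inverse 0<1+1))

  double : ∀ x → (1# + 1#) * x ≈ x + x
  double x = R.trans (R.distribʳ x 1# 1#) (R.+-cong (R.*-identityˡ x) (R.*-identityˡ x))

  ½x+½x≈x : ∀ x → ½ * x + ½ * x ≈ x
  ½x+½x≈x x = R.trans (R.sym (double (½ * x))) (R.trans (R.sym (R.*-assoc _ ½ x))
    (R.trans (R.*-congʳ (proj₂ (proj₂ (pos-inverse 0<1+1)))) (R.*-identityˡ x)))

  ½[x+x]≈x : ∀ x → ½ * (x + x) ≈ x
  ½[x+x]≈x x = R.trans (R.distribˡ ½ x x) (½x+½x≈x x)

  common-lower-bound : ∀ {x y} → 0# < x → 0# < y → ∃[ z ] 0# < z × z ≤ x × z ≤ y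
  common-lower-bound {x} {y} 0<x 0<y with O.total x y
  ... | inj₁ x≤y = x , 0<x , O.refl , x≤y
  ... | inj₂ y≤x = y , 0<y , y≤x , O.refl

  -- With `η` at most 1 and at most ε/(c+1), `η ^ suc m ≤ η`, so the product is at most cε/(c+1) <
  -- ε. The divisor is c+1 because `c` may be 0.
  small-power : ∀ c {ε} m → 0# ≤ c → 0# < ε → ∃[ η ] 0# < η × c * η ^ suc m < ε
  small-power c {ε} m 0≤c 0<ε with pos-inverse 0<c+1
    where
    0<c+1 : 0# < c + 1#
    0<c+1 = <-≤-trans 0<1 (x≤y+x 0≤c)
  ... | y , 0<y , [c+1]y≈1 with common-lower-bound 0<1 (*-pos 0<y 0<ε)
  ... | η , 0<η , η≤1 , η≤yε = η , 0<η , (begin-strict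
    c * (η * η ^ m)      ≤⟨ *-monoʳ-≤ c 0≤c (*-monoʳ-≤ η (inj₁ 0<η) (x≤1⇒x^n≤1 m (inj₁ 0<η) η≤1)) ⟩
    c * (η * 1#)         ≈⟨ R.*-congˡ (R.*-identityʳ η) ⟩
    c * η                ≤⟨ *-monoʳ-≤ c 0≤c η≤yε ⟩
    c * (y * ε)          ≈⟨ R.+-identityʳ _ ⟨
    c * (y * ε) + 0#     <⟨ +-monoʳ-< _ (*-pos 0<y 0<ε) ⟩
    c * (y * ε) + y * ε  ≈⟨ R.+-congˡ (R.*-identityˡ _) ⟨
    c * (y * ε) + 1# * (y * ε)  ≈⟨ R.distribʳ (y * ε) c 1# ⟨
    (c + 1#) * (y * ε)   ≈⟨ R.*-assoc (c + 1#) y ε ⟨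
    (c + 1#) * y * ε     ≈⟨ R.*-congʳ [c+1]y≈1 ⟩
    1# * ε               ≈⟨ R.*-identityˡ ε ⟩
    ε                    ∎)

  -- A δ beyond x may be taken to be twice the maximum of x and a small η.
  enlarge : ∀ {c x ε} m → 0# ≤ c → 0# ≤ x → 0# < ε → c * x ^ suc m < ½ ^ suc m * ε →
            ∃[ δ ] x < δ × 0# < δ × c * δ ^ suc m < ε
  enlarge {c} {x} {ε} m 0≤c 0≤x 0<ε cx^m< =
    case small-power c m 0≤c (*-pos (^-pos (suc m) 0<½) 0<ε) of λ where
      (η , 0<η , cη^m<) → case O.total x η of λ where
        (inj₁ x≤η) → η + η , ≤-<-trans x≤η (η<η+η 0<η) , S.trans 0<η (η<η+η 0<η) , bound cη^m<
        (inj₂ η≤x) → let 0<x = <-≤-trans 0<η η≤x in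
          x + x , η<η+η 0<x , S.trans 0<x (η<η+η 0<x) , bound cx^m<
    where
    η<η+η : ∀ {η} → 0# < η → η < η + η
    η<η+η {η} 0<η = begin-strict
      η       ≈⟨ R.+-identityʳ η ⟨
      η + 0#  <⟨ +-monoʳ-< η 0<η ⟩
      η + η   ∎

    -- Doubling `z` multiplies the power by 2 to the `suc m`, which the factor `½ ^ suc m` in the
    -- hypothesis compensates.
    bound : ∀ {z} → c * z ^ suc m < ½ ^ suc m * ε → c * (z + z) ^ suc m < ε
    bound {z} p = *-cancelˡ-< (½ ^ suc m) (inj₁ (^-pos (suc m) 0<½)) (begin-strict
      ½ ^ suc m * (c * (z + z) ^ suc m)    ≈⟨ R.*-assoc _ _ _ ⟨
      ½ ^ suc m * c * (z + z) ^ suc m      ≈⟨ R.*-congʳ (R.*-comm _ c) ⟩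
      c * ½ ^ suc m * (z + z) ^ suc m      ≈⟨ R.*-assoc _ _ _ ⟩
      c * (½ ^ suc m * (z + z) ^ suc m)    ≈⟨ R.*-congˡ (^-distrib-* ½ (z + z) (suc m)) ⟨
      c * (½ * (z + z)) ^ suc m            ≈⟨ R.*-congˡ (^-congˡ (suc m) (½[x+x]≈x z)) ⟩
      c * z ^ suc m                        <⟨ p ⟩
      ½ ^ suc m * ε                        ∎)

module Theorem (em : ExcludedMiddle 0ℓ) (ℛ : Reals) where
  open Reals ℛ
  open Approximation ℛ
  open OrderedField ℛ
  module NS = ExtremaNonStrict _≤_
  module ST = ExtremaStrict _<_

  -- Extended-real infima, suprema and limits inferior.

  [x]≰⊥± : ∀ {x} → ¬ [ x ] ≤± ⊥±
  [x]≰⊥± SupremumNonStrict.[ () ]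

  -- Completeness yields suprema only, so the infimum is the supremum of the set of lower bounds.
  -- The index `i₀` bounds that set from above and excludes `⊤±` as a lower bound.
  infimum : {I : Set} (f : I → ℝ) → I → ∀ {b} → (∀ i → b ≤ f i) →
            ∃[ s ] IsInf ([_] ∘ f) [ s ]
  infimum {I} f i₀ {b} b≤f
    with complete (λ x → ∀ i → x ≤ f i) (b , b≤f) (f i₀ , λ x≤f → x≤f i₀)
  ... | s , s-upper , s-least = s , (λ i → NS.[ s-least (λ x≤f → x≤f i) ]) , greatest
    where
    greatest : ∀ b → (∀ i → b ≤± [ f i ]) → b ≤± [ s ]
    greatest ⊥±    _  = NS.⊥±≤ _
    greatest [ b ] le = NS.[ s-upper (NS.[≤]-injective ∘ le) ]
    greatest ⊤±    le with le i₀
    ... | ()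

  -- Excluded middle decides whether `t` is bounded. If it is not, no real is an upper bound and the
  -- supremum is `⊤±`, which can happen for the infima over tails.
  supremum : (t : ℕ → ℝ) → ∃[ u ] IsSup ([_] ∘ t) u
  supremum t with em {∃[ b ] ∀ i → t i ≤ b}
  ... | yes (b , t≤b)
    with complete (λ x → ∃[ i ] x ≈ t i) (t 0 , 0 , R.refl)
           (b , λ { (i , x≈ti) → O.trans (inj₂ x≈ti) (t≤b i) })
  ... | s , s-upper , s-least = [ s ] , (λ i → NS.[ s-upper (i , R.refl) ]) , least
    where
    least : ∀ b → (∀ i → [ t i ] ≤± b) → [ s ] ≤± b
    least ⊥±    le = contradiction (le 0) [x]≰⊥±
    least [ b ] le =
      NS.[ s-least (λ { (i , x≈ti) → O.trans (inj₂ x≈ti) (NS.[≤]-injective (le i)) }) ]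
    least ⊤±    _  = _ NS.≤⊤±
  supremum t | no unbounded = ⊤± , (λ i → _ NS.≤⊤±) , least
    where
    least : ∀ b → (∀ i → [ t i ] ≤± b) → ⊤± ≤± b
    least ⊥±    le = contradiction (le 0) [x]≰⊥±
    least [ b ] le = contradiction (b , NS.[≤]-injective ∘ le) unbounded
    least ⊤±    _  = _ NS.≤⊤±

  -- If no positive constant bounds `f` from below on any tail, every tail infimum is at most 0, and
  -- so is their supremum `l`. The doubly negated form is enough for refuting membership in `Bad`.
  liminf-pos⇒bounded-below : ∀ {n} {f : Vector ℤ n → ℝ} {l} → IsLimInf f l → [ 0# ] <± l →
    ¬ (∀ {ε} → 0# < ε → ∀ N → ¬ (∀ q → N ℕ.≤ ‖ q ‖ᶻ → ε ≤ f q))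
  liminf-pos⇒bounded-below {f = f} {l} (t , inf , sup) 0<l unbounded =
    ST.<±-irrefl-≡ (λ { ≡.refl → S.irrefl R.refl }) ≡.refl
      (ST.<±-transˡ <-≤-trans 0<l (proj₂ sup [ 0# ] nonpos))
    where
    nonpos : ∀ N → t N ≤± [ 0# ]
    nonpos N with t N | inf N
    ... | ⊥±    | _ = NS.⊥±≤ _
    -- An infimum `⊤±` means an empty tail, on which the lower bound 1 holds vacuously.
    ... | ⊤±    | t≤f , _ = contradiction
      (λ q N≤q → case t≤f (q , N≤q) of λ ()) (unbounded 0<1 N)
    ... | [ x ] | t≤f , _ = NS.[ ≮⇒≥ (λ 0<x → unbounded 0<x N
      (λ q N≤q → NS.[≤]-injective (t≤f (q , N≤q)))) ]

  -- Constant vectors show that every tail is inhabited once the dimension is positive.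
  ‖const‖ᶻ : ∀ n N → ‖ (λ (_ : Fin.Fin (suc n)) → + N) ‖ᶻ ≡ N
  ‖const‖ᶻ zero    N = ℕ.⊔-identityʳ N
  ‖const‖ᶻ (suc n) N = ≡.trans (≡.cong (N ℕ.⊔_) (‖const‖ᶻ n N)) (ℕ.⊔-idem N)

  -- Non-negativity makes every tail infimum a real number. The one at `N` is at least `ε`, and the
  -- limit inferior is at least that.
  bounded-below⇒liminf-pos : ∀ {n} (f : Vector ℤ (suc n) → ℝ) → (∀ q → 0# ≤ f q) →
    ∀ {ε} → 0# < ε → ∀ N → (∀ q → N ℕ.≤ ‖ q ‖ᶻ → ε ≤ f q) →
    ∃[ l ] IsLimInf f l × [ 0# ] <± l
  bounded-below⇒liminf-pos {n} f 0≤f {ε} 0<ε N ε≤f =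
    l , ([_] ∘ t , inf , sup) ,
    ST.<±-transˡ <-≤-trans ST.[ 0<ε ]
      (NS.≤±-trans O.trans (proj₂ (inf N) [ ε ] (λ (q , N≤q) → NS.[ ε≤f q N≤q ])) (proj₁ sup N))
    where
    tail-infimum : ∀ N → ∃[ s ] IsInf {Σ[ q ∈ Vector ℤ (suc n) ] N ℕ.≤ ‖ q ‖ᶻ}
                                      (λ (q , _) → [ f q ]) [ s ]
    tail-infimum N = infimum (f ∘ proj₁) ((λ _ → + N) , ℕ.≤-reflexive (≡.sym (‖const‖ᶻ n N)))
                             (0≤f ∘ proj₁)
    t = proj₁ ∘ tail-infimum
    inf = proj₂ ∘ tail-infimum
    l = proj₁ (supremum t)
    sup = proj₂ (supremum t)

  -- Monotone convergence, partial sums, and the decay forced by summability.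

  monotone-bounded⇒converges : (s : ℕ → ℝ) → (∀ k → s k ≤ s (suc k)) →
    ∀ {b} → (∀ k → s k ≤ b) → Converges s
  monotone-bounded⇒converges s step s≤b
    with complete (λ x → ∃[ k ] x ≈ s k) (s 0 , 0 , R.refl)
           (_ , λ { (k , x≈sk) → O.trans (inj₂ x≈sk) (s≤b k) })
  ... | l , l-upper , l-least = l , close
    where
    s≤l : ∀ k → s k ≤ l
    s≤l k = l-upper (k , R.refl)

    close : ∀ {ε} → 0# < ε → ∃[ N ] ∀ {k} → N ℕ.≤ k → ∣ s k - l ∣ < ε
    close {ε} 0<ε with em {∃[ N ] l - ε < s N}
    ... | yes (N , l-ε<sN) = N , near
      where
      near : ∀ {k} → N ℕ.≤ k → ∣ s k - l ∣ < ε
      near {k} N≤k with M.⊔-sel (s k - l) (- (s k - l))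
      ... | inj₁ eq = ≤-<-trans (inj₂ eq) (≤-<-trans
        (O.trans (+-monoˡ-≤ (- l) (s≤l k)) (inj₂ (R.-‿inverseʳ l))) 0<ε)
      ... | inj₂ eq = ≤-<-trans (inj₂ eq) (+-cancelˡ-< (s k - l) (begin-strict
        s k - l + - (s k - l)  ≈⟨ R.-‿inverseʳ _ ⟩
        0#                     ≈⟨ R.-‿inverseʳ l ⟨
        l - l                  <⟨ +-monoˡ-< (- l) l<sk+ε ⟩
        s k + ε - l            ≈⟨ R.+-assoc _ _ _ ⟩
        s k + (ε - l)          ≈⟨ R.+-congˡ (R.+-comm ε (- l)) ⟩
        s k + (- l + ε)        ≈⟨ R.+-assoc _ _ _ ⟨
        s k - l + ε            ∎))
        where
        l<sk+ε : l < s k + ε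
        l<sk+ε = <-≤-trans (x-y<z⇒x<z+y l-ε<sN)
          (+-monoˡ-≤ ε (step⇒mono {_~_ = _≤_} O.refl O.trans s step N≤k))
    ... | no none = contradiction (l-least l-ε-upper) (λ l≤l-ε → ≤⇒≯ l≤l-ε l-ε<l)
      where
      l-ε-upper : ∀ {x} → ∃[ k ] x ≈ s k → x ≤ l - ε
      l-ε-upper (k , x≈sk) = O.trans (inj₂ x≈sk) (≮⇒≥ (λ p → none (k , p)))

      l-ε<l : l - ε < l
      l-ε<l = begin-strict
        l - ε       ≈⟨ R.+-identityʳ _ ⟨
        l - ε + 0#  <⟨ +-monoʳ-< (l - ε) 0<ε ⟩
        l - ε + ε   ≈⟨ x-y+y l ε ⟩
        l           ∎

  -- `sum` unfolds at its first term, while the inductions on partial sums add a last one.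
  partialSum-suc : ∀ a k → partialSum a (suc k) ≈ partialSum a k + a (suc k)
  partialSum-suc a k = R.trans (Sum.sum-init-last R.+-monoid {k} (a ∘ suc ∘ toℕ))
    (R.+-cong
      (R.reflexive (Sum.sum-cong-≗ R.+-monoid {k} (≡.cong (a ∘ suc) ∘ toℕ-inject₁)))
      (R.reflexive (≡.cong (a ∘ suc) (toℕ-fromℕ k))))

  partialSum-+ : ∀ a {x} k j → (∀ {q} → k ℕ.< q → q ℕ.≤ k ℕ.+ j → x ≤ a q) →
                 partialSum a k + j · x ≤ partialSum a (k ℕ.+ j)
  partialSum-+ a {x} k zero    x≤a rewrite ℕ.+-identityʳ k = inj₂ (R.+-identityʳ _)
  partialSum-+ a {x} k (suc j) x≤a rewrite ℕ.+-suc k j = begin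
    partialSum a k + (x + j · x)                 ≈⟨ R.+-congˡ (R.+-comm x _) ⟩
    partialSum a k + (j · x + x)                 ≈⟨ R.+-assoc _ _ _ ⟨
    partialSum a k + j · x + x                   ≤⟨ +-mono-≤
      (partialSum-+ a k j (λ k<q q≤ → x≤a k<q (ℕ.m≤n⇒m≤1+n q≤)))
      (x≤a (s≤s (ℕ.m≤m+n k j)) ℕ.≤-refl) ⟩
    partialSum a (k ℕ.+ j) + a (suc (k ℕ.+ j))   ≈⟨ partialSum-suc a (k ℕ.+ j) ⟨
    partialSum a (suc (k ℕ.+ j))                 ∎

  -- Cauchy condensation: the block of terms between Q / 2 and Q already
  -- contributes about Qⁿ ψ(Q)ᵐ to the series.
  critical-decay : ∀ {m n} (c : 𝒞 m (suc n)) (let open 𝒞 c) → ∀ {ε} → 0# < ε →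
    ∃[ N ] ∀ {Q} → N ℕ.≤ Q → (Q · 1#) ^ suc n * ψ Q ^ m < ε
  critical-decay {m} {n} c {ε} 0<ε with proj₂ (𝒞.summable c) 0<ε′
    where
    0<ε′ : 0# < ½ * (½ ^ suc n * ε)
    0<ε′ = *-pos 0<½ (*-pos (^-pos (suc n) 0<½) 0<ε)
  -- Doubling `N` keeps ⌊Q/2⌋ at least `N`, so `close` applies at both ends of the block.
  ... | N , close = N ℕ.+ N , small
    where
    open 𝒞 c
    -- Both `s k` and `s Q` lie within `ε′` of the limit, so the block sums to less than `ε′ + ε′`,
    -- which is `½ ^ suc n * ε`. The power of `½` pays for replacing Q by Q/2.
    ε′ = ½ * (½ ^ suc n * ε)
    a : ℕ → ℝ
    a q = (q · 1#) ^ n * ψ q ^ m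
    s = partialSum a

    small : ∀ {Q} → N ℕ.+ N ℕ.≤ Q → (Q · 1#) ^ suc n * ψ Q ^ m < ε
    small {Q} 2N≤Q = *-cancelˡ-< (½ ^ suc n) (inj₁ (^-pos (suc n) 0<½)) (begin-strict
      ½ ^ suc n * ((Q · 1#) ^ suc n * ψ Q ^ m)  ≈⟨ R.*-assoc _ _ _ ⟨
      ½ ^ suc n * (Q · 1#) ^ suc n * ψ Q ^ m    ≈⟨ R.*-congʳ (^-distrib-* ½ (Q · 1#) (suc n)) ⟨
      (½ * (Q · 1#)) ^ suc n * ψ Q ^ m          ≤⟨ *-monoˡ-≤ _ 0≤ψ^m
        (^-monoˡ-≤ (suc n) (*-nonneg (inj₁ 0<½) (·-nonneg Q)) ½Q≤j) ⟩
      (j · 1#) * (j · 1#) ^ n * ψ Q ^ m         ≈⟨ R.*-assoc _ _ _ ⟩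
      (j · 1#) * x                              ≈⟨ ×-assoc-* j 1# x ⟩
      j · (1# * x)                              ≈⟨ Mult.×-congʳ R.semiring j (R.*-identityˡ x) ⟩
      j · x                                     <⟨ +-cancelˡ-< (s k) block ⟩
      ε′ + ε′                                   ≈⟨ ½x+½x≈x _ ⟩
      ½ ^ suc n * ε                             ∎)
      where
      k = ⌊ Q /2⌋
      j = ⌈ Q /2⌉
      -- A lower bound for every term of the block: k < q ≤ Q gives q ≥ k+1 ≥ j and `ψ q ≥ ψ Q`. The
      -- block has exactly `j` terms, which supplies the missing factor `j`.
      x = (j · 1#) ^ n * ψ Q ^ m

      0≤ψ^m : 0# ≤ ψ Q ^ m
      0≤ψ^m = ^-nonneg m (nonneg Q)

      N≤k : N ℕ.≤ k
      N≤k = ≡.subst (ℕ._≤ k) (≡.sym (ℕ.n≡⌊n+n/2⌋ N)) (ℕ.⌊n/2⌋-mono 2N≤Q)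

      k≤Q : k ℕ.≤ Q
      k≤Q = ℕ.⌊n/2⌋≤n Q

      j≤1+k : j ℕ.≤ suc k
      j≤1+k = ℕ.⌊n/2⌋-mono {suc Q} {suc (suc Q)} (ℕ.n≤1+n _)

      ½Q≤j : ½ * (Q · 1#) ≤ j · 1#
      ½Q≤j = begin
        ½ * (Q · 1#)             ≤⟨ *-monoʳ-≤ ½ (inj₁ 0<½) (·-mono Q≤j+j) ⟩
        ½ * ((j ℕ.+ j) · 1#)     ≈⟨ R.*-congˡ (×-homo-+ 1# j j) ⟩
        ½ * (j · 1# + j · 1#)    ≈⟨ ½[x+x]≈x _ ⟩
        j · 1#                   ∎
        where
        Q≤j+j : Q ℕ.≤ j ℕ.+ j
        Q≤j+j = ℕ.≤-trans (ℕ.≤-reflexive (≡.sym (ℕ.⌊n/2⌋+⌈n/2⌉≡n Q)))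
                          (ℕ.+-monoˡ-≤ j (ℕ.⌊n/2⌋≤⌈n/2⌉ Q))

      x≤a : ∀ {q} → k ℕ.< q → q ℕ.≤ k ℕ.+ j → x ≤ a q
      x≤a {q} k<q q≤Q = *-mono-≤ (^-nonneg n (·-nonneg j)) 0≤ψ^m
        (^-monoˡ-≤ n (·-nonneg j) (·-mono (ℕ.≤-trans j≤1+k k<q)))
        (^-monoˡ-≤ m (nonneg Q) (decreasing
          (ℕ.≤-trans q≤Q (ℕ.≤-reflexive (ℕ.⌊n/2⌋+⌈n/2⌉≡n Q)))))

      l = proj₁ summable

      l<ε′+sk : l < ε′ + s k
      l<ε′+sk = x-y<z⇒x<z+y (begin-strict
        l - s k      ≈⟨ R.+-congʳ (RP.-‿involutive l) ⟨
        - - l - s k  ≈⟨ RP.-‿+-comm (- l) (s k) ⟩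
        - (- l + s k) ≈⟨ R.-‿cong (R.+-comm (- l) (s k)) ⟩
        - (s k - l)  ≤⟨ -x≤∣x∣ (s k - l) ⟩
        ∣ s k - l ∣  <⟨ close N≤k ⟩
        ε′           ∎)

      block : s k + j · x < s k + (ε′ + ε′)
      block = begin-strict
        s k + j · x        ≤⟨ partialSum-+ a k j x≤a ⟩
        s (k ℕ.+ j)        ≡⟨ ≡.cong s (ℕ.⌊n/2⌋+⌈n/2⌉≡n Q) ⟩
        s Q                <⟨ x-y<z⇒x<z+y (≤-<-trans (x≤∣x∣ (s Q - l)) (close (ℕ.≤-trans N≤k k≤Q))) ⟩
        ε′ + l             <⟨ +-monoʳ-< ε′ l<ε′+sk ⟩
        ε′ + (ε′ + s k)    ≈⟨ R.+-assoc ε′ ε′ (s k) ⟨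
        ε′ + ε′ + s k      ≈⟨ R.+-comm _ (s k) ⟩
        s k + (ε′ + ε′)    ∎

  -- The step function with prescribed thresholds and values, and its convergent series.

  module StepFunction (m n : ℕ) (Q : ℕ → ℕ) (δ : ℕ → ℝ)
    (Q-step : ∀ k → Q k ℕ.< Q (suc k)) (0≤δ : ∀ k → 0# ≤ δ k)
    (δ-step : ∀ k → δ (suc k) ≤ δ k)
    (small : ∀ k → (Q k · 1#) ^ suc n * δ k ^ m ≤ ½ ^ k) where

    -- Kept apart from `level` so that `invariant-step` can take the decision as an argument and
    -- `carry` can match on it.
    advance : ∀ {P : Set} → Dec P → ℕ → ℕ
    advance (yes _) k = k
    advance (no _)  k = suc k

    -- The least k with q ≤ Q k. Raising it by at most one per step suffices because `Q` is strictly
    -- increasing.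
    level : ℕ → ℕ
    level zero    = zero
    level (suc q) = advance (suc q ℕ.≤? Q (level q)) (level q)

    level-step : ∀ q → level q ℕ.≤ level (suc q)
    level-step q with suc q ℕ.≤? Q (level q)
    ... | yes _ = ℕ.≤-refl
    ... | no _  = ℕ.n≤1+n _

    q≤Q[level] : ∀ q → q ℕ.≤ Q (level q)
    q≤Q[level] zero = z≤n
    q≤Q[level] (suc q) with suc q ℕ.≤? Q (level q)
    ... | yes q<Q = q<Q
    ... | no _    = ℕ.≤-<-trans (q≤Q[level] q) (Q-step (level q))

    level-least : ∀ {k} q → q ℕ.≤ Q k → level q ℕ.≤ k
    level-least zero _ = z≤n
    level-least (suc q) q<Qk with suc q ℕ.≤? Q (level q)
    ... | yes _ = level-least q (ℕ.<⇒≤ q<Qk)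
    ... | no q≮Q = ℕ.≤∧≢⇒< (level-least q (ℕ.<⇒≤ q<Qk)) λ { ≡.refl → q≮Q q<Qk }

    δ-antitone : ∀ {p q} → p ℕ.≤ q → δ q ≤ δ p
    δ-antitone = step⇒mono {_~_ = λ x y → y ≤ x} O.refl (λ y≤x z≤y → O.trans z≤y y≤x) δ δ-step

    ψ : ℕ → ℝ
    ψ = δ ∘ level

    -- The threshold `Q k` has level at most `k`. Hence a point of norm `Q k` at distance below
    -- `δ k` solves the inequality for `ψ`.
    δ≤ψ[Q] : ∀ k → δ k ≤ ψ (Q k)
    δ≤ψ[Q] k = δ-antitone (level-least (Q k) ℕ.≤-refl)

    a : ℕ → ℝ
    a q = (q · 1#) ^ n * ψ q ^ m

    s : ℕ → ℝ
    s = partialSum a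

    0≤a : ∀ q → 0# ≤ a q
    0≤a q = *-nonneg (^-nonneg n (·-nonneg q)) (^-nonneg m (0≤δ (level q)))

    -- K·Kⁿ ≤ K(K+1)ⁿ, and adding (K+1)ⁿ gives (K+1)ⁿ⁺¹. This is the inductive step in bounding the
    -- sum of qⁿ up to K by Kⁿ⁺¹.
    power-step : ∀ K {x} → 0# ≤ x → (K · 1#) ^ suc n * x + (suc K · 1#) ^ n * x ≤
                                    (suc K · 1#) ^ suc n * x
    power-step K {x} 0≤x = begin
      k * k ^ n * x + k′ ^ n * x         ≈⟨ R.distribʳ x _ _ ⟨
      (k * k ^ n + k′ ^ n) * x           ≤⟨ *-monoˡ-≤ x 0≤x (+-monoˡ-≤ _ (*-monoʳ-≤ k (·-nonneg K)
        (^-monoˡ-≤ n (·-nonneg K) (x≤y+x (inj₁ 0<1))))) ⟩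
      (k * k′ ^ n + k′ ^ n) * x          ≈⟨ R.*-congʳ (R.+-comm _ _) ⟩
      (k′ ^ n + k * k′ ^ n) * x          ≈⟨ R.*-congʳ (R.+-congʳ (R.*-identityˡ _)) ⟨
      (1# * k′ ^ n + k * k′ ^ n) * x     ≈⟨ R.*-congʳ (R.distribʳ _ 1# k) ⟨
      (1# + k) * k′ ^ n * x              ∎
      where
      k  = K · 1#
      k′ = suc K · 1#

    -- The terms after the last threshold below K sum to at most Kⁿ⁺¹ δ(k)ᵐ, and
    -- the earlier blocks contribute at most ½⁰ + … + ½ᵏ⁻¹ = 2 - 2 ½ᵏ.
    Invariant : ℕ → ℕ → Set
    Invariant K k = s K + (½ ^ k + ½ ^ k) ≤ 1# + 1# + (K · 1#) ^ suc n * δ k ^ m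

    -- Up to the threshold `Q k`, `small` bounds the last term of the invariant by `½ ^ k`, which
    -- cancels one of the two copies on the left. It serves both the passage to the next level and
    -- the final bound 2.
    bounded-at : ∀ K k → K ℕ.≤ Q k → Invariant K k → s K + ½ ^ k ≤ 1# + 1#
    bounded-at K k K≤Qk inv = +-cancelˡ-≤ (½ ^ k) (begin
      ½ ^ k + (s K + ½ ^ k)                   ≈⟨ R.+-comm _ _ ⟩
      s K + ½ ^ k + ½ ^ k                     ≈⟨ R.+-assoc _ _ _ ⟩
      s K + (½ ^ k + ½ ^ k)                   ≤⟨ inv ⟩
      1# + 1# + (K · 1#) ^ suc n * δ k ^ m    ≤⟨ +-monoʳ-≤ _ (*-monoˡ-≤ _ (^-nonneg m (0≤δ k))
        (^-monoˡ-≤ (suc n) (·-nonneg K) (·-mono K≤Qk))) ⟩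
      1# + 1# + (Q k · 1#) ^ suc n * δ k ^ m  ≤⟨ +-monoʳ-≤ _ (small k) ⟩
      1# + 1# + ½ ^ k                         ≈⟨ R.+-comm _ _ ⟩
      ½ ^ k + (1# + 1#)                       ∎)

    -- `carry` rewrites the invariant at `K` for the level of `suc K`; then `power-step` absorbs the
    -- new term.
    invariant-step : ∀ K k (d : Dec (suc K ℕ.≤ Q k)) → K ℕ.≤ Q k → Invariant K k →
      s (suc K) ≈ s K + (suc K · 1#) ^ n * δ (advance d k) ^ m →
      Invariant (suc K) (advance d k)
    invariant-step K k d K≤Qk inv sum-suc = begin
      s (suc K) + h                                      ≈⟨ R.+-congʳ sum-suc ⟩
      s K + b + h                                        ≈⟨ R.+-assoc _ _ _ ⟩
      s K + (b + h)                                      ≈⟨ R.+-congˡ (R.+-comm b h) ⟩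
      s K + (h + b)                                      ≈⟨ R.+-assoc _ _ _ ⟨
      s K + h + b                                        ≤⟨ +-monoˡ-≤ b (carry d) ⟩
      1# + 1# + (K · 1#) ^ suc n * x + b                 ≈⟨ R.+-assoc _ _ _ ⟩
      1# + 1# + ((K · 1#) ^ suc n * x + b)               ≤⟨ +-monoʳ-≤ _ (power-step K 0≤x) ⟩
      1# + 1# + (suc K · 1#) ^ suc n * x                 ∎
      where
      h = ½ ^ advance d k + ½ ^ advance d k
      x = δ (advance d k) ^ m
      b = (suc K · 1#) ^ n * x

      0≤x : 0# ≤ x
      0≤x = ^-nonneg m (0≤δ (advance d k))

      carry : (d : Dec (suc K ℕ.≤ Q k)) → s K + (½ ^ advance d k + ½ ^ advance d k) ≤
                                          1# + 1# + (K · 1#) ^ suc n * δ (advance d k) ^ m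
      carry (yes _) = inv
      -- Past a threshold the two halves `½ ^ suc k` add up to `½ ^ k`, so `bounded-at` closes the
      -- old block and the new one starts with room to spare.
      carry (no _)  = begin
        s K + (½ ^ suc k + ½ ^ suc k)                ≈⟨ R.+-congˡ (½x+½x≈x (½ ^ k)) ⟩
        s K + ½ ^ k                                  ≤⟨ bounded-at K k K≤Qk inv ⟩
        1# + 1#                                      ≤⟨ x≤x+y (*-nonneg
          (^-nonneg (suc n) (·-nonneg K)) (^-nonneg m (0≤δ (suc k)))) ⟩
        1# + 1# + (K · 1#) ^ suc n * δ (suc k) ^ m   ∎

    invariant : ∀ K → Invariant K (level K)
    invariant zero = begin
      0# + (1# + 1#)                       ≈⟨ R.+-identityˡ _ ⟩
      1# + 1#                              ≤⟨ x≤x+y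
        (*-nonneg (^-nonneg (suc n) O.refl) (^-nonneg m (0≤δ 0))) ⟩
      1# + 1# + (0 · 1#) ^ suc n * δ 0 ^ m  ∎
    invariant (suc K) = invariant-step K (level K) (suc K ℕ.≤? Q (level K))
      (q≤Q[level] K) (invariant K) (partialSum-suc a K)

    class : 𝒞 m (suc n)
    class = record
      { ψ          = ψ
      ; nonneg     = 0≤δ ∘ level
      ; decreasing = δ-antitone ∘ step⇒mono {_~_ = ℕ._≤_} ℕ.≤-refl ℕ.≤-trans level level-step
      ; summable   = monotone-bounded⇒converges s s-step s≤2
      }
      where
      s-step : ∀ k → s k ≤ s (suc k)
      s-step k = O.trans (x≤x+y (0≤a (suc k))) (inj₂ (R.sym (partialSum-suc a k)))

      s≤2 : ∀ k → s k ≤ 1# + 1#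
      s≤2 k = O.trans (x≤x+y (^-nonneg (level k) (inj₁ 0<½)))
                      (bounded-at k (level k) (q≤Q[level] k) (invariant k))

  -- Finite sets of integer vectors as sets of bounded norm.

  ‖‖ᶻ-cong : ∀ {n} {p q : Vector ℤ n} → p ≗ q → ‖ p ‖ᶻ ≡ ‖ q ‖ᶻ
  ‖‖ᶻ-cong {zero}  p≗q = ≡.refl
  ‖‖ᶻ-cong {suc n} p≗q = ≡.cong₂ ℕ._⊔_ (≡.cong ℤ.∣_∣ (p≗q Fin.zero)) (‖‖ᶻ-cong (p≗q ∘ Fin.suc))

  interval : ℕ → List ℤ
  interval N = List.map +_ (upTo (suc N)) ++ List.map -[1+_] (upTo N)

  ∈-interval : ∀ {N} z → ℤ.∣ z ∣ ℕ.≤ N → z List.∈ interval N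
  ∈-interval (+ k)    k≤N = ∈-++⁺ˡ (∈-map⁺ +_ (∈-upTo⁺ (s≤s k≤N)))
  ∈-interval -[1+ k ] k<N = ∈-++⁺ʳ _ (∈-map⁺ -[1+_] (∈-upTo⁺ k<N))

  box : ∀ n → ℕ → List (Vector ℤ n)
  box zero    N = (λ ()) ∷ []
  box (suc n) N = cartesianProductWith Vector._∷_ (interval N) (box n N)

  ∈-box : ∀ {n N} (q : Vector ℤ n) → ‖ q ‖ᶻ ℕ.≤ N → Any (q ≗_) (box n N)
  ∈-box {zero}  q _ = here λ ()
  ∈-box {suc n} q ‖q‖≤N = cartesianProductWith⁺ Vector._∷_
    (λ { q₀≡x q≗y Fin.zero → q₀≡x ; q₀≡x q≗y (Fin.suc i) → q≗y i })
    (∈-interval (q Fin.zero) (ℕ.m⊔n≤o⇒m≤o _ _ ‖q‖≤N))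
    (∈-box (q ∘ Fin.suc) (ℕ.m⊔n≤o⇒n≤o _ _ ‖q‖≤N))

  -- Together with `finite⇒bounded` this reduces "infinitely many solutions" to "solutions of
  -- unbounded norm", the form used in both inclusions.
  bounded⇒finite : ∀ {n} {P : Pred (Vector ℤ n) 0ℓ} N → (∀ {q} → q ∈ P → ‖ q ‖ᶻ ℕ.≤ N) → Finite P
  bounded⇒finite N P≤N = box _ N , λ {q} q∈P → ∈-box q (P≤N q∈P)

  finite⇒bounded : ∀ {n} {P : Pred (Vector ℤ n) 0ℓ} → Finite P → ∃[ N ] ∀ {q} → q ∈ P → ‖ q ‖ᶻ ℕ.≤ N
  finite⇒bounded (qs , listed) = bound qs , λ q∈P → below qs (listed q∈P)
    where
    bound : ∀ {n} → List (Vector ℤ n) → ℕ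
    bound = List.foldr (λ p N → ‖ p ‖ᶻ ℕ.⊔ N) 0

    below : ∀ {n} {q : Vector ℤ n} ps → Any (q ≗_) ps → ‖ q ‖ᶻ ℕ.≤ bound ps
    below (p ∷ ps) (here q≗p) = ℕ.≤-trans (ℕ.≤-reflexive (‖‖ᶻ-cong q≗p)) (ℕ.m≤m⊔n _ _)
    below (p ∷ ps) (there i)  = ℕ.≤-trans (below ps i) (ℕ.m≤n⊔m _ _)

  -- Distances to the integer points and the two inclusions.

  0≤‖‖ : ∀ {m} (x : Vector ℝ m) → 0# ≤ ‖ x ‖
  0≤‖‖ {zero}  x = O.refl
  0≤‖‖ {suc m} x = O.trans (0≤‖‖ (x ∘ Fin.suc)) (M.x≤y⊔x _ _)

  0≤⟨⟩ : ∀ {m} (y : Vector ℝ m) → 0# ≤ ⟨ y ⟩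
  0≤⟨⟩ y = 0≤‖‖ (y -ᵥ Vector.map ι (proj₁ (nearestPoint y)))

  module _ {m n : ℕ} (A : Matrix (suc m) (suc n)) (γ : Vector ℝ (suc m)) where

    dist : Vector ℤ (suc n) → ℝ
    dist q = ⟨ A *ᵥ Vector.map ι q -ᵥ γ ⟩

    0≤dist : ∀ q → 0# ≤ dist q
    0≤dist q = 0≤⟨⟩ (A *ᵥ Vector.map ι q -ᵥ γ)

    scaled : Vector ℤ (suc n) → ℝ
    scaled q = (‖ q ‖ᶻ · 1#) ^ suc n * dist q ^ suc m

    0≤scaled : ∀ q → 0# ≤ scaled q
    0≤scaled q = *-nonneg (^-nonneg (suc n) (·-nonneg ‖ q ‖ᶻ)) (^-nonneg (suc m) (0≤dist q))

    -- Where `scaled` is at least `ε` and `critical-decay` has pushed the same expression in `ψ`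
    -- below `ε`, no solution exists. All solutions then have bounded norm, so they are finite in
    -- number.
    W⇒¬Bad : (c : 𝒞 (suc m) (suc n)) → (A , γ) ∈ W (suc m) (suc n) (𝒞.ψ c) →
             ¬ (A , γ) ∈ Bad (suc m) (suc n)
    W⇒¬Bad c (_ , infinite) (_ , l , isLimInf , 0<l) =
      liminf-pos⇒bounded-below isLimInf 0<l λ {ε} 0<ε N ε≤scaled →
        let N′ , decay = critical-decay c 0<ε
            bounded : ∀ {q} → dist q < 𝒞.ψ c ‖ q ‖ᶻ → ‖ q ‖ᶻ ℕ.≤ N ℕ.⊔ N′
            bounded {q} close = ℕ.≮⇒≥ λ far → ≤⇒≯
              (ε≤scaled q (ℕ.m⊔n≤o⇒m≤o N N′ (ℕ.<⇒≤ far)))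
              (≤-<-trans
                (*-monoʳ-≤ _ (^-nonneg (suc n) (·-nonneg ‖ q ‖ᶻ))
                  (^-monoˡ-≤ (suc m) (0≤dist q) (inj₁ close)))
                (decay (ℕ.m⊔n≤o⇒n≤o N N′ (ℕ.<⇒≤ far))))
        in infinite (bounded⇒finite (N ℕ.⊔ N′) (λ {q} → bounded {q}))

    -- The radius `δ` stands in for the distance, which may be 0: the inequality in `W` is strict,
    -- and a positive radius leaves a positive tolerance for the next choice.
    Approximant : ℕ → ℝ → Set
    Approximant N ε = Σ[ q ∈ Vector ℤ (suc n) ] ∃[ δ ]
      N ℕ.≤ ‖ q ‖ᶻ × dist q < δ × 0# < δ × (‖ q ‖ᶻ · 1#) ^ suc n * δ ^ suc m < ε

    module Sequence (approx : ∀ N {ε} → 0# < ε → Approximant N ε) where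

      point : ∀ {N ε} → Approximant N ε → Vector ℤ (suc n)
      point = proj₁

      radius : ∀ {N ε} → Approximant N ε → ℝ
      radius = proj₁ ∘ proj₂

      0<radius : ∀ {N ε} (a : Approximant N ε) → 0# < radius a
      0<radius (_ , _ , _ , _ , 0<δ , _) = 0<δ

      -- The first bound yields `small`, the second yields `δ-step`.
      tolerance : ∀ k {N ε} (a : Approximant N ε) →
                  ∃[ ε′ ] 0# < ε′ × ε′ ≤ ½ ^ suc k × ε′ ≤ radius a ^ suc m
      tolerance k a = common-lower-bound (^-pos (suc k) 0<½) (^-pos (suc m) (0<radius a))

      next : ∀ k {N ε} (a : Approximant N ε) →
             Approximant (suc ‖ point a ‖ᶻ) (proj₁ (tolerance k a))
      next k a = approx (suc ‖ point a ‖ᶻ) (proj₁ (proj₂ (tolerance k a)))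

      stage : ℕ → ∃[ N ] ∃[ ε ] Approximant N ε
      -- The initial tolerance is `½ ^ 0`, as `small` demands at 0.
      stage zero    = 0 , 1# , approx 0 0<1
      stage (suc k) = _ , _ , next k (proj₂ (proj₂ (stage k)))

      approximant : ∀ k → Approximant (proj₁ (stage k)) (proj₁ (proj₂ (stage k)))
      approximant k = proj₂ (proj₂ (stage k))

      Q : ℕ → ℕ
      Q k = ‖ point (approximant k) ‖ᶻ

      δ : ℕ → ℝ
      δ k = radius (approximant k)

      Q-step : ∀ k → Q k ℕ.< Q (suc k)
      Q-step k = let _ , _ , Qk<Q , _ = approximant (suc k) in Qk<Q

      k≤Q : ∀ k → k ℕ.≤ Q k
      k≤Q zero    = z≤n
      k≤Q (suc k) = ℕ.≤-<-trans (k≤Q k) (Q-step k)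

      0≤δ : ∀ k → 0# ≤ δ k
      0≤δ k = inj₁ (0<radius (approximant k))

      small : ∀ k → (Q k · 1#) ^ suc n * δ k ^ suc m ≤ ½ ^ k
      small zero    = let _ , _ , _ , _ , _ , p = approximant 0 in inj₁ p
      small (suc k) =
        let _ , _ , _ , _ , _ , p = approximant (suc k)
            _ , _ , ε≤½^ , _ = tolerance k (approximant k)
        in O.trans (inj₁ p) ε≤½^

      -- The norm `Q (suc k)` is at least 1, so the power of the new radius is at most the scaled
      -- quantity, which lies below the power of the old radius by the choice of tolerance.
      δ-step : ∀ k → δ (suc k) ≤ δ k
      δ-step k =
        let _ , _ , Qk<Q , _ , _ , p = approximant (suc k)
            _ , _ , _ , ε≤δ^ = tolerance k (approximant k)
        in inj₁ (^-cancelˡ-< (suc m) (0≤δ k) (begin-strict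
          δ (suc k) ^ suc m                                  ≤⟨ 1≤x⇒y≤x*y
            (^-nonneg (suc m) (0≤δ (suc k)))
            (1≤x⇒1≤x^n (suc n) (O.trans (inj₂ (R.sym (R.+-identityʳ 1#)))
              (·-mono {1} (ℕ.≤-trans (s≤s z≤n) Qk<Q)))) ⟩
          (Q (suc k) · 1#) ^ suc n * δ (suc k) ^ suc m       <⟨ p ⟩
          proj₁ (tolerance k (approximant k))                ≤⟨ ε≤δ^ ⟩
          δ k ^ suc m                                        ∎))

      open StepFunction (suc m) n Q δ Q-step 0≤δ δ-step small

      infinite : ¬ Finite (λ q → dist q < ψ ‖ q ‖ᶻ)
      infinite finite =
        let N , bounded = finite⇒bounded finite
            -- The index `suc N` forces a norm of at least N+1, beyond the supposed bound `N`.
            q , _ , _ , dist<δ , _ = approximant (suc N)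
        in ℕ.≤⇒≯ (bounded {q} (<-≤-trans dist<δ (δ≤ψ[Q] (suc N)))) (k≤Q (suc N))

      ∈Λ : (A , γ) ∈ Cube (suc m) (suc n) → (A , γ) ∈ Λ (suc m) (suc n)
      ∈Λ cube = class , cube , infinite

    -- By `enlarge`, a point of the tail with `scaled q` below `½ ^ suc m * ε` would give an
    -- approximant. Without any, that constant bounds `scaled` from below on the tail, which puts
    -- the pair in `Bad`.
    approximable : (A , γ) ∈ Cube (suc m) (suc n) → ¬ (A , γ) ∈ Bad (suc m) (suc n) →
                   ∀ N {ε} → 0# < ε → Approximant N ε
    approximable cube ¬bad N {ε} 0<ε = em⇒dne em λ none →
      ¬bad (cube , bounded-below⇒liminf-pos scaled 0≤scaled
        (*-pos (^-pos (suc m) 0<½) 0<ε) N λ q N≤q → ≮⇒≥ λ scaled< →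
          case enlarge m (^-nonneg (suc n) (·-nonneg ‖ q ‖ᶻ)) (0≤dist q) 0<ε scaled< of λ where
            (δ , dist<δ , 0<δ , p) → none (q , δ , N≤q , dist<δ , 0<δ , p))

theorem1p6 : ExcludedMiddle 0ℓ → (ℛ : Reals) →
    (m n : ℕ) → .{{_ : NonZero m}} → .{{_ : NonZero n}} →
    let open Approximation ℛ in
    Λ m n ≐ (Cube m n ∖ Bad m n)
theorem1p6 em ℛ (suc m) (suc n) =
  (λ { {A , γ} (c , cube , infinite) → cube , W⇒¬Bad A γ c (cube , infinite) }) ,
  (λ { {A , γ} (cube , ¬bad) → Sequence.∈Λ A γ (approximable A γ cube ¬bad) cube })
  where open Theorem em ℛ
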